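{- Let $p\ge 3$ and $n\ge 0$ be integers, let $D$ be a $p$-angulation of an $(n+3)$-gon, and let $(m_{i,j})$ be the frieze of type $\Lambda_p$ and width $n$ corresponding to $D$. Let $v_0,\dots,v_{n+2}$ be the vertices of the associated Farey path. Then for every $0\le\alpha\le n+2$, $$v_\alpha=\frac{m_{0,\alpha-1}}{m_{1,\alpha-1}}.$$
   Context: A frieze of width $n$ is an array of real numbers $(m_{i,j})$, indexed by $i\in\mathbb{Z}$ and $j$ with $-2\le j-i\le n+1$, such that $m_{i,i-2}=m_{i,i+n+1}=0$, $m_{i,i-1}=m_{i,i+n}=1$, the remaining entries are positive, and the unimodular rule $m_{i,i+r}m_{i+1,i+r+1}-m_{i+1,i+r}m_{i,i+r+1}=1$ holds for all $i\in\mathbb{Z}$ and $-1\le r\le n$. The row $(m_{i,i})_{i\in\mathbb{Z}}$ is called the quiddity row; it determines the frieze via $m_{i,i+r}=m_{i,i}m_{i+1,i+r}-m_{i+2,i+r}$. A $p$-angulation $D$ of a convex regular polygon $P$ is a set of non-intersecting diagonals partitioning $P$ into a finite collection of $p$-gons. Let $P$ have $n+3$ vertices, labelled $0,1,\dots,n+2$ in cyclic order. Let $q_\alpha$ be the number of $p$-gons of $D$ incident with the vertex $\alpha$, and let $\lambda_p=2\cos(\pi/p)$. The frieze of type $\Lambda_p$ corresponding to $D$ is the frieze of width $n$ with $m_{i,i}=\lambda_p q_{i\bmod (n+3)}$ for all $i\in\mathbb{Z}$ (it is known that such a frieze exists and is unique). Define Möbius transformations $\xi_\alpha(z)=q_\alpha\lambda_p-\frac1z$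 for $0\le\alpha\le n+2$, acting on $\mathbb{R}\cup\{\infty\}$, and the vertices of the associated Farey path by $v_0=\infty$ and $v_\alpha=\xi_0\xi_1\cdots\xi_{\alpha-1}(\infty)$ (composition of maps) for $1\le\alpha\le n+2$. The convention $\frac10=\infty$ is used. -}

module Defs where

open import Algebra.Bundles using (CommutativeRing; Semiring)
import Algebra.Definitions
open import Algebra.Definitions.RawSemiring using (_×_; _^_; sum)
open import Algebra.Structures using (IsCommutativeRing)
open import Data.Bool.Base using (true; false)
open import Data.Fin.Base as Fin using (Fin; toℕ; fromℕ<; inject)
open import Data.Fin.Properties using (_<?_; all?) renaming (_≟_ to _≟ᶠ_)
open import Data.Fin.Subset using (Subset; _∈_; ⊤; ∣_∣)
open import Data.Fin.Subset.Properties using (_∈?_)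
open import Data.Integer.Base as ℤ using (ℤ; +_; 0ℤ; 1ℤ; -1ℤ)
open import Data.Integer.DivMod using (_%ℕ_; n%ℕd<d)
open import Data.List.Base as List using (List; []; _∷_; _++_; length; filter)
open import Data.Nat.Base as ℕ using (ℕ; zero; suc; NonZero; _!)
import Data.Nat.Properties as ℕ
open import Data.Product.Base using (∃; ∃-syntax; _,_; proj₁) renaming (_×_ to _∧_)
open import Data.Sum.Base using (_⊎_)
open import Data.Vec.Base as Vec using ()
open import Data.Vec.Functional using (foldr)
open import Level using (Level; _⊔_; 0ℓ) renaming (suc to lsuc)
open import Relation.Binary.Core using (Rel)
open import Relation.Binary.Definitions using (Decidable; Symmetric)
import Relation.Binary.Construct.Add.Point.Equality
import Relation.Binary.Construct.StrictToNonStrict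
open import Relation.Binary.PropositionalEquality.Core using (_≡_; _≢_)
open import Relation.Binary.Structures using (IsStrictTotalOrder)
open import Relation.Nullary.Construct.Add.Point using (Pointed; ∙; [_])
open import Relation.Nullary.Decidable.Core using (Dec; yes; no; ¬?; _×-dec_; _⊎-dec_; _→-dec_)
open import Relation.Nullary.Negation.Core using (¬_)
open import Relation.Unary using (Pred)

------------------------------------------------------------------------
-- The real numbers, as a Dedekind-complete totally ordered field.
-- These axioms determine them up to isomorphism.  Trichotomy makes equality
-- decidable, as in classical analysis.

record Reals (c ℓ₁ ℓ₂ : Level) : Set (lsuc (c ⊔ ℓ₁ ⊔ ℓ₂)) where
  infix  8 -_
  infixl 7 _*_
  infixl 6 _+_
  infix  4 _≈_ _<_
  field
    Carrier : Set c
    _≈_     : Rel Carrier ℓ₁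
    _<_     : Rel Carrier ℓ₂
    _+_ _*_ : Carrier → Carrier → Carrier
    -_      : Carrier → Carrier
    0# 1#   : Carrier

  open Algebra.Definitions _≈_ using (Invertible)
  open Relation.Binary.Construct.StrictToNonStrict _≈_ _<_ public using (_≤_)

  UpperBound : ∀ {ℓ} → Pred Carrier ℓ → Pred Carrier (c ⊔ ℓ₁ ⊔ ℓ₂ ⊔ ℓ)
  UpperBound P u = ∀ x → P x → x ≤ u

  LeastUpperBound : ∀ {ℓ} → Pred Carrier ℓ → Pred Carrier (c ⊔ ℓ₁ ⊔ ℓ₂ ⊔ ℓ)
  LeastUpperBound P s = UpperBound P s ∧ (∀ u → UpperBound P u → s ≤ u)

  field
    isCommutativeRing  : IsCommutativeRing _≈_ _+_ _*_ -_ 0# 1#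
    0≉1                : ¬ 0# ≈ 1#
    invertible         : ∀ x → ¬ x ≈ 0# → Invertible 1# _*_ x
    isStrictTotalOrder : IsStrictTotalOrder _≈_ _<_
    +-monoˡ-<          : ∀ z {x y} → x < y → x + z < y + z
    *-positive         : ∀ {x y} → 0# < x → 0# < y → 0# < x * y
    complete           : ∀ (P : Pred Carrier (c ⊔ ℓ₁ ⊔ ℓ₂)) →
                         ∃ P → ∃ (UpperBound P) → ∃ (LeastUpperBound P)

  commutativeRing : CommutativeRing c ℓ₁
  commutativeRing = record { isCommutativeRing = isCommutativeRing }

  open CommutativeRing commutativeRing public
    using (_-_; semiring)
  open Semiring semiring public using (rawSemiring)
  open IsStrictTotalOrder isStrictTotalOrder public using (_≟_)

  infix 8 _⁻¹

  -- Total, with 0# ⁻¹ = 0#; only ever used at nonzero arguments.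
  _⁻¹ : Carrier → Carrier
  x ⁻¹ with x ≟ 0#
  ... | yes _  = 0#
  ... | no x≉0 = proj₁ (invertible x x≉0)

  infixl 7 _/ℕ_
  infixr 8 _·_

  _·_ : ℕ → Carrier → Carrier
  _·_ = _×_ rawSemiring

  _/ℕ_ : Carrier → ℕ → Carrier
  x /ℕ k = x * (k · 1#) ⁻¹

  Converges : (ℕ → Carrier) → Carrier → Set (c ⊔ ℓ₂)
  Converges s l = ∀ ε → 0# < ε →
    ∃[ K ] ∀ k → K ℕ.≤ k → (- ε < s k - l) ∧ (s k - l < ε)

  cosTerm : Carrier → ℕ → Carrier
  cosTerm x k = ((- 1#) ^ᴿ k * x ^ᴿ (2 ℕ.* k)) /ℕ ((2 ℕ.* k) !)
    where _^ᴿ_ = _^_ rawSemiring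

  IsCos : Carrier → Carrier → Set (c ⊔ ℓ₂)
  IsCos x = Converges (λ k → sum rawSemiring {k} (λ i → cosTerm x (toℕ i)))

  -- π / 2 is the smallest positive zero of the cosine.
  IsPi : Carrier → Set (c ⊔ ℓ₂)
  IsPi π = (0# < π) ∧ IsCos (π /ℕ 2) 0# ∧
           (∀ x → 0# < x → x < π /ℕ 2 → ¬ IsCos x 0#)

  -- l = 2 cos (π / p)
  Is2Cosπ/ : ℕ → Carrier → Set (c ⊔ ℓ₁ ⊔ ℓ₂)
  Is2Cosπ/ p l = ∃[ π ] ∃[ y ] IsPi π ∧ IsCos (π /ℕ p) y ∧ l ≈ 2 · y

  open Relation.Binary.Construct.Add.Point.Equality _≈_ public using (_≈∙_)

  -- The real line with the point ∙ at infinity.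
  Carrier∞ : Set c
  Carrier∞ = Pointed Carrier

  -- The convention is 1 / 0 = ∞; the value of 0 / 0 is immaterial.
  infixl 7 _÷_
  _÷_ : Carrier → Carrier → Carrier∞
  x ÷ y with y ≟ 0#
  ... | yes _ = ∙
  ... | no  _ = [ x * y ⁻¹ ]

  reciprocal : Carrier∞ → Carrier∞
  reciprocal ∙     = [ 0# ]
  reciprocal [ x ] = 1# ÷ x

  infixl 6 _-∞_
  _-∞_ : Carrier → Carrier∞ → Carrier∞
  a -∞ ∙     = ∙
  a -∞ [ x ] = [ a - x ]

------------------------------------------------------------------------
-- Dissections of a convex polygon with vertices Fin N in cyclic order.
-- Which diagonals cross depends only on the cyclic order of the vertices.

module _ {N : ℕ} where

  -- i, j, k are distinct and met in this order going round the polygon.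
  Cyclic : (i j k : Fin N) → Set
  Cyclic i j k = (i Fin.< j ∧ j Fin.< k) ⊎ (j Fin.< k ∧ k Fin.< i) ⊎ (k Fin.< i ∧ i Fin.< j)

  cyclic? : ∀ i j k → Dec (Cyclic i j k)
  cyclic? i j k = ((i <? j) ×-dec (j <? k)) ⊎-dec ((j <? k) ×-dec (k <? i))
                  ⊎-dec ((k <? i) ×-dec (i <? j))

  -- j is the vertex following i on the polygon with vertex set S.
  Next : Subset N → Rel (Fin N) 0ℓ
  Next S i j = i ≢ j ∧ i ∈ S ∧ j ∈ S ∧ (∀ k → k ∈ S → ¬ Cyclic i k j)

  next? : ∀ S → Decidable (Next S)
  next? S i j = ¬? (i ≟ᶠ j) ×-dec (i ∈? S) ×-dec (j ∈? S) ×-dec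
                all? (λ k → (k ∈? S) →-dec ¬? (cyclic? i k j))

  -- The segment i j is a side of the convex hull of S.
  Side : Subset N → Rel (Fin N) 0ℓ
  Side S i j = Next S i j ⊎ Next S j i

  side? : ∀ S → Decidable (Side S)
  side? S i j = next? S i j ⊎-dec next? S j i

  Diagonal : Rel (Fin N) 0ℓ
  Diagonal i j = i ≢ j ∧ ¬ Side ⊤ i j

  Crossing : (i j k l : Fin N) → Set
  Crossing i j k l = Cyclic i k j ∧ Cyclic j l i

record Dissection (N : ℕ) : Set₁ where
  infix 4 _~_ _~?_
  field
    _~_         : Rel (Fin N) 0ℓ
    _~?_        : Decidable _~_
    symmetric   : Symmetric _~_
    diagonal    : ∀ {i j} → i ~ j → Diagonal i j
    noncrossing : ∀ {i j k l} → i ~ j → k ~ l → ¬ Crossing i j k l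

  -- The convex hull of S is one of the pieces into which the diagonals cut
  -- the polygon: it is bounded by sides and diagonals, and no diagonal
  -- runs through its interior.  (Such a diagonal would have to join two
  -- vertices in S, as otherwise it would cross a side of the hull.)
  Piece : Subset N → Set
  Piece S = 3 ℕ.≤ ∣ S ∣
          ∧ (∀ i j → Side S i j → Side ⊤ i j ⊎ i ~ j)
          ∧ (∀ i j → i ∈ S → j ∈ S → i ~ j → Side S i j)

  piece? : ∀ S → Dec (Piece S)
  piece? S = (3 ℕ.≤? ∣ S ∣)
    ×-dec all? (λ i → all? (λ j → side? S i j →-dec (side? ⊤ i j ⊎-dec (i ~? j))))
    ×-dec all? (λ i → all? (λ j → (i ∈? S) →-dec ((j ∈? S) →-dec ((i ~? j) →-dec side? S i j))))

record Angulation (p N : ℕ) : Set₁ where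
  field
    dissection : Dissection N
  open Dissection dissection public
  field
    angular : ∀ S → Piece S → ∣ S ∣ ≡ p

subsets : ∀ n → List (Subset n)
subsets zero    = Vec.[] ∷ []
subsets (suc n) = List.map (true Vec.∷_) (subsets n) ++ List.map (false Vec.∷_) (subsets n)

-- The number of p-gons incident with a given vertex.
incidence : ∀ {p N} → Angulation p N → Fin N → ℕ
incidence {N = N} D α = length (filter (λ S → piece? S ×-dec (α ∈? S)) (subsets N))
  where open Angulation D

infixl 7 _modFin_
_modFin_ : ℤ → (N : ℕ) .{{_ : NonZero N}} → Fin N
i modFin N = fromℕ< (n%ℕd<d i N)

------------------------------------------------------------------------

module Friezes {c ℓ₁ ℓ₂} (ℝ : Reals c ℓ₁ ℓ₂) where
  open Reals ℝ

  -- Only the entries m i j with -2 ≤ j - i ≤ n + 1 belong to the frieze; the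
  -- other values of m are unconstrained.
  record IsFrieze (n : ℕ) (m : ℤ → ℤ → Carrier) : Set (ℓ₁ ⊔ ℓ₂) where
    field
      zeroˡ      : ∀ i → m i (i ℤ.- + 2) ≈ 0#
      zeroʳ      : ∀ i → m i (i ℤ.+ + n ℤ.+ 1ℤ) ≈ 0#
      oneˡ       : ∀ i → m i (i ℤ.- 1ℤ) ≈ 1#
      oneʳ       : ∀ i → m i (i ℤ.+ + n) ≈ 1#
      positive   : ∀ i j → i ℤ.≤ j → j ℤ.< i ℤ.+ + n → 0# < m i j
      unimodular : ∀ i r → -1ℤ ℤ.≤ r → r ℤ.≤ + n →
                   m i (i ℤ.+ r) * m (i ℤ.+ 1ℤ) (i ℤ.+ r ℤ.+ 1ℤ)
                   - m (i ℤ.+ 1ℤ) (i ℤ.+ r) * m i (i ℤ.+ r ℤ.+ 1ℤ) ≈ 1#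

  module _ {p n : ℕ} (D : Angulation p (3 ℕ.+ n)) (λₚ : Carrier) where

    record IsFriezeOf (m : ℤ → ℤ → Carrier) : Set (ℓ₁ ⊔ ℓ₂) where
      field
        isFrieze : IsFrieze n m
        quiddity : ∀ i → m i i ≈ incidence D (i modFin (3 ℕ.+ n)) · λₚ

    ξ : Fin (3 ℕ.+ n) → Carrier∞ → Carrier∞
    ξ α z = (incidence D α · λₚ) -∞ reciprocal z

    -- The vertex ξ₀ (ξ₁ (… ξ_{α-1} (∞))) of the Farey path: the vector
    -- inject {i = α} lists the indices 0, …, α - 1.
    fareyVertex : Fin (3 ℕ.+ n) → Carrier∞
    fareyVertex α = foldr ξ ∙ (inject {i = α})

{-# OPTIONS --safe #-}

-- By induction on k, ξᵢ ξᵢ₊₁ ⋯ ξᵢ₊ₖ₋₁ (∞) = mᵢ,ᵢ₊ₖ₋₁ / mᵢ₊₁,ᵢ₊ₖ₋₁: applying ξᵢ to the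
-- quotient b / c gives (mᵢᵢ b - c) / b, which is the recurrence
-- mᵢⱼ = mᵢᵢ mᵢ₊₁,ⱼ - mᵢ₊₂,ⱼ.  The recurrence follows from the unimodular rule, as
-- its instances in rows i and i + 1 together show that (mᵢⱼ + mᵢ₊₂,ⱼ) / mᵢ₊₁,ⱼ does
-- not depend on j.

module Submission where

open import Defs
open import Data.Nat.Base as ℕ using (ℕ; zero; suc)
open import Data.Integer.Base as ℤ using (ℤ; +_; 0ℤ; 1ℤ; -1ℤ)
open import Data.Fin.Base using (Fin; zero; suc; toℕ; inject)

open import Algebra.Bundles using (CommutativeRing)
import Algebra.Properties.Group as GroupProperties
import Algebra.Solver.Ring.NaturalCoefficients.Default as SemiringSolver
open import Data.Fin.Properties using (toℕ-injective; toℕ-fromℕ<; toℕ-inject; toℕ<n)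
import Data.Integer.Properties as ℤ
open import Data.Nat.DivMod using (m<n⇒m%n≡m)
import Data.Nat.Properties as ℕ
open import Data.Product.Base using (proj₂)
open import Data.Sum.Base using (inj₁; inj₂)
open import Data.Vec.Functional using (foldr; tail)
open import Relation.Binary.PropositionalEquality as ≡ using (_≡_)
import Relation.Binary.Construct.Add.Point.Equality as PointEquality
import Relation.Binary.Reasoning.Setoid as SetoidReasoning
open import Relation.Binary.Structures using (IsStrictTotalOrder)
open import Relation.Nullary.Construct.Add.Point using (∙; [_])
open import Relation.Nullary.Decidable.Core using (yes; no)
open import Relation.Nullary.Negation.Core using (¬_; contradiction)

module RealProperties {c ℓ₁ ℓ₂} (ℝ : Reals c ℓ₁ ℓ₂) where
  open Reals ℝ
  open PointEquality _≈_ using (∙≈∙; [_])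
  open CommutativeRing commutativeRing
    using ( setoid; refl; sym; trans; +-congˡ; +-congʳ; *-congˡ; *-congʳ; *-assoc; *-comm
          ; *-identityˡ; *-identityʳ; zeroˡ; distribˡ; distribʳ; +-group; commutativeSemiring )
  open GroupProperties +-group using (∙-cancelʳ; //-rightDividesˡ)
  open SetoidReasoning setoid

  positive⇒nonzero : ∀ {x} → 0# < x → ¬ x ≈ 0#
  positive⇒nonzero 0<x x≈0 = IsStrictTotalOrder.irrefl isStrictTotalOrder (sym x≈0) 0<x

  ⁻¹-inverseʳ : ∀ {x} → ¬ x ≈ 0# → x * x ⁻¹ ≈ 1#
  ⁻¹-inverseʳ {x} x≉0 with x ≟ 0#
  ... | yes x≈0 = contradiction x≈0 x≉0
  ... | no  x≉0 = proj₂ (proj₂ (invertible x x≉0))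

  *-/-cancelʳ : ∀ {y} x → ¬ y ≈ 0# → x * y * y ⁻¹ ≈ x
  *-/-cancelʳ {y} x y≉0 = begin
    x * y * y ⁻¹    ≈⟨ *-assoc x y (y ⁻¹) ⟩
    x * (y * y ⁻¹)  ≈⟨ *-congˡ (⁻¹-inverseʳ y≉0) ⟩
    x * 1#          ≈⟨ *-identityʳ x ⟩
    x               ∎

  *-cancelʳ-nonzero : ∀ {x y z} → ¬ z ≈ 0# → x * z ≈ y * z → x ≈ y
  *-cancelʳ-nonzero {x} {y} {z} z≉0 xz≈yz = begin
    x             ≈⟨ *-/-cancelʳ x z≉0 ⟨
    x * z * z ⁻¹  ≈⟨ *-congʳ xz≈yz ⟩
    y * z * z ⁻¹  ≈⟨ *-/-cancelʳ y z≉0 ⟩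
    y             ∎

  ÷-zeroʳ : ∀ x {y} → y ≈ 0# → ∙ ≈∙ x ÷ y
  ÷-zeroʳ x {y} y≈0 with y ≟ 0#
  ... | yes _   = ∙≈∙
  ... | no  y≉0 = contradiction y≈0 y≉0

  ÷-nonzeroʳ : ∀ x {y} → ¬ y ≈ 0# → x ÷ y ≡ [ x * y ⁻¹ ]
  ÷-nonzeroʳ x {y} y≉0 with y ≟ 0# in eq
  ... | yes y≈0 = contradiction y≈0 y≉0
  -- Unfolding `x ÷ y` in this case exposes a `y ⁻¹` whose own test `y ≟ 0#` escaped the case split;
  -- `eq` evaluates it.
  ... | no  _ rewrite eq = ≡.refl

  ÷-unique : ∀ {x y z} → ¬ y ≈ 0# → z * y ≈ x → [ z ] ≈∙ x ÷ y
  ÷-unique {x} {y} {z} y≉0 zy≈x rewrite ÷-nonzeroʳ x y≉0 =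
    [ trans (sym (*-/-cancelʳ z y≉0)) (*-congʳ zy≈x) ]

  -- In `ξ-÷` the point `z` is known only up to `≈∙`, so facts about the denominator have to be read
  -- off from the shape of `z`. This lemma and the next two do so.
  ÷-infinite⇒zeroʳ : ∀ {x y} → ∙ ≈∙ x ÷ y → y ≈ 0#
  ÷-infinite⇒zeroʳ {y = y} ∙≈x÷y with y ≟ 0# | ∙≈x÷y
  ... | yes y≈0 | _  = y≈0
  ... | no  _   | ()

  ÷-finite⇒nonzeroʳ : ∀ {x y z} → [ z ] ≈∙ x ÷ y → ¬ y ≈ 0#
  ÷-finite⇒nonzeroʳ {y = y} z≈x÷y with y ≟ 0# | z≈x÷y
  ... | yes _   | ()
  ... | no  y≉0 | _ = y≉0

  ÷-finite⇒* : ∀ {x y z} → [ z ] ≈∙ x ÷ y → z * y ≈ x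
  ÷-finite⇒* {x} {y} {z} z≈x÷y with y≉0 ← ÷-finite⇒nonzeroʳ z≈x÷y
    with [ z≈x/y ] ← ≡.subst ([ z ] ≈∙_) (÷-nonzeroʳ x y≉0) z≈x÷y = begin
    z * y           ≈⟨ *-congʳ z≈x/y ⟩
    x * y ⁻¹ * y    ≈⟨ *-assoc x (y ⁻¹) y ⟩
    x * (y ⁻¹ * y)  ≈⟨ *-congˡ (*-comm (y ⁻¹) y) ⟩
    x * (y * y ⁻¹)  ≈⟨ *-assoc x y (y ⁻¹) ⟨
    x * y * y ⁻¹    ≈⟨ *-/-cancelʳ x y≉0 ⟩
    x               ∎

  x-y≈z⇒x≈z+y : ∀ {x y z} → x - y ≈ z → x ≈ z + y
  x-y≈z⇒x≈z+y {x} {y} {z} x-y≈z = begin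
    x          ≈⟨ //-rightDividesˡ y x ⟨
    x - y + y  ≈⟨ +-congʳ x-y≈z ⟩
    z + y      ∎

  -- This is `q - c / b = (q b - c) / b`, with the numerator given by an equation free of
  -- subtraction. Only `b` has to be nonzero: if `c` vanishes, then `z` is the point at infinity.
  ξ-÷ : ∀ {q a b c z} → ¬ b ≈ 0# → a + c ≈ q * b → z ≈∙ b ÷ c →
        (q -∞ reciprocal z) ≈∙ a ÷ b
  ξ-÷ {q} {a} {b} {c} b≉0 a+c≈qb = by-cases _
    where
    -- Here `w` is the value of `reciprocal z`, that is, of `c / b`. Adding `c` to both sides
    -- removes the subtraction from the goal.
    translate : ∀ w → w * b ≈ c → [ q - w ] ≈∙ a ÷ b
    translate w wb≈c = ÷-unique b≉0 (∙-cancelʳ c _ _ (begin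
      (q - w) * b + c      ≈⟨ +-congˡ wb≈c ⟨
      (q - w) * b + w * b  ≈⟨ distribʳ b (q - w) w ⟨
      (q - w + w) * b      ≈⟨ *-congʳ (//-rightDividesˡ w q) ⟩
      q * b                ≈⟨ a+c≈qb ⟨
      a + c                ∎))

    by-cases : ∀ z → z ≈∙ b ÷ c → (q -∞ reciprocal z) ≈∙ a ÷ b
    by-cases ∙ ∙≈b÷c = translate 0# (trans (zeroˡ b) (sym (÷-infinite⇒zeroʳ ∙≈b÷c)))
    by-cases [ x ] x≈b÷c =
      ≡.subst (λ w → (q -∞ w) ≈∙ a ÷ b) (≡.sym (÷-nonzeroʳ 1# x≉0)) (translate (1# * x ⁻¹) (begin
      1# * x ⁻¹ * b    ≈⟨ *-congʳ (*-identityˡ (x ⁻¹)) ⟩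
      x ⁻¹ * b         ≈⟨ *-congˡ xc≈b ⟨
      x ⁻¹ * (x * c)   ≈⟨ *-comm (x ⁻¹) (x * c) ⟩
      x * c * x ⁻¹     ≈⟨ *-congʳ (*-comm x c) ⟩
      c * x * x ⁻¹     ≈⟨ *-/-cancelʳ c x≉0 ⟩
      c                ∎))
      where
      xc≈b : x * c ≈ b
      xc≈b = ÷-finite⇒* x≈b÷c

      -- Since `b` is nonzero, so is `x`, and its reciprocal is finite.
      x≉0 : ¬ x ≈ 0#
      x≉0 x≈0 = b≉0 (trans (sym xc≈b) (trans (*-congʳ x≈0) (zeroˡ c)))

  -- The letters are the entries of three successive rows in two adjacent columns. Add
  -- `b * a′ + c * b′` to each of the two equal determinants.
  unimodular-exchange : ∀ {a b c a′ b′ c′} → a * b′ - b * a′ ≈ 1# → b * c′ - c * b′ ≈ 1# →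
                        (a + c) * b′ ≈ b * (a′ + c′)
  unimodular-exchange {a} {b} {c} {a′} {b′} {c′} ab bc = begin
    (a + c) * b′           ≈⟨ distribʳ b′ a c ⟩
    a * b′ + c * b′        ≈⟨ +-congʳ (x-y≈z⇒x≈z+y ab) ⟩
    1# + b * a′ + c * b′   ≈⟨ solve 3 (λ x y z → x :+ y :+ z := y :+ (x :+ z)) refl _ _ _ ⟩
    b * a′ + (1# + c * b′) ≈⟨ +-congˡ (x-y≈z⇒x≈z+y bc) ⟨
    b * a′ + b * c′        ≈⟨ distribˡ b a′ c′ ⟨
    b * (a′ + c′)          ∎
    where open SemiringSolver commutativeSemiring

module FriezeProperties {c ℓ₁ ℓ₂} (ℝ : Reals c ℓ₁ ℓ₂) where
  open Reals ℝ
  open Friezes ℝ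
  open RealProperties ℝ
  open CommutativeRing commutativeRing
    using ( setoid; refl; sym; trans; +-congˡ; +-congʳ; *-congˡ; *-congʳ; *-comm; *-identityʳ
          ; +-identityʳ; commutativeSemiring )
  open SetoidReasoning setoid

  module _ {n m} (F : IsFrieze n m) where
    open IsFrieze F

    private
      M : ℕ → ℕ → Carrier
      M i j = m (+ i) (+ j)

    -- In row `i + 1`, the columns from `i` to `i + n + 1` are those strictly between the bordering
    -- zeros: the entry is 1 at either end and positive in between.
    next-row-nonzero : ∀ i r → r ℕ.≤ suc n → ¬ M (suc i) (i ℕ.+ r) ≈ 0#
    next-row-nonzero i zero _ M≈0 rewrite ℕ.+-identityʳ i =
      0≉1 (trans (sym M≈0) (oneˡ (+ suc i)))
    next-row-nonzero i (suc r) (ℕ.s≤s r≤n) rewrite ℕ.+-suc i r with ℕ.m≤n⇒m<n∨m≡n r≤n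
    ... | inj₁ r<n = positive⇒nonzero (positive _ _ (ℤ.+≤+ (ℕ.m≤m+n (suc i) r))
                       (ℤ.+<+ (ℕ.+-monoʳ-< (suc i) r<n)))
    ... | inj₂ ≡.refl = λ M≈0 → 0≉1 (trans (sym M≈0) (oneʳ (+ suc i)))

    unimodular-row : ∀ i r → r ℕ.≤ n →
      M i (i ℕ.+ r) * M (suc i) (suc (i ℕ.+ r)) - M (suc i) (i ℕ.+ r) * M i (suc (i ℕ.+ r)) ≈ 1#
    unimodular-row i r r≤n
      with eq ← unimodular (+ i) (+ r) ℤ.-≤+ (ℤ.+≤+ r≤n)
      rewrite ℕ.+-comm i 1 | ℕ.+-comm (i ℕ.+ r) 1 = eq

    unimodular-next-row : ∀ i r → r ℕ.≤ suc n →
      M (suc i) (i ℕ.+ r) * M (2 ℕ.+ i) (suc (i ℕ.+ r))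
        - M (2 ℕ.+ i) (i ℕ.+ r) * M (suc i) (suc (i ℕ.+ r)) ≈ 1#
    -- In row `i + 1` the column offset is `r - 1`, here -1, which the natural offsets of
    -- `unimodular-row` do not reach.
    unimodular-next-row i zero _
      with eq ← unimodular (+ suc i) -1ℤ ℤ.≤-refl ℤ.-≤+
      rewrite ℕ.+-identityʳ i | ℕ.+-comm i 1 = eq
    unimodular-next-row i (suc r) (ℕ.s≤s r≤n) rewrite ℕ.+-suc i r = unimodular-row (suc i) r r≤n

    -- Induction on the column, starting at column `i`, where row `i + 2` has a 0 and row `i + 1` a
    -- 1.
    recurrence : ∀ i r → r ℕ.≤ suc n →
      M i (i ℕ.+ r) + M (2 ℕ.+ i) (i ℕ.+ r) ≈ M i i * M (suc i) (i ℕ.+ r)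
    recurrence i zero _ rewrite ℕ.+-identityʳ i = begin
      M i i + M (2 ℕ.+ i) i  ≈⟨ +-congˡ (zeroˡ (+ (2 ℕ.+ i))) ⟩
      M i i + 0#             ≈⟨ +-identityʳ (M i i) ⟩
      M i i                  ≈⟨ *-identityʳ (M i i) ⟨
      M i i * 1#             ≈⟨ *-congˡ (oneˡ (+ suc i)) ⟨
      M i i * M (suc i) i    ∎
    recurrence i (suc r) (ℕ.s≤s r≤n) rewrite ℕ.+-suc i r =
      -- The factor cancelled is the row `i + 1` entry of the previous column `j`, where the
      -- induction hypothesis applies.
      *-cancelʳ-nonzero (next-row-nonzero i r r≤1+n) (begin
        (M i j′ + M (2 ℕ.+ i) j′) * M (suc i) j  ≈⟨ *-comm _ _ ⟩
        M (suc i) j * (M i j′ + M (2 ℕ.+ i) j′)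
          ≈⟨ unimodular-exchange (unimodular-row i r r≤n) (unimodular-next-row i r r≤1+n) ⟨
        (M i j + M (2 ℕ.+ i) j) * M (suc i) j′   ≈⟨ *-congʳ (recurrence i r r≤1+n) ⟩
        M i i * M (suc i) j * M (suc i) j′
          ≈⟨ solve 3 (λ x y z → x :* y :* z := x :* z :* y) refl _ _ _ ⟩
        M i i * M (suc i) j′ * M (suc i) j       ∎)
      where
      open SemiringSolver commutativeSemiring
      j = i ℕ.+ r
      j′ = suc j

      r≤1+n : r ℕ.≤ suc n
      r≤1+n = ℕ.m≤n⇒m≤1+n r≤n

  modFin-toℕ : ∀ {N} .{{_ : ℕ.NonZero N}} (α : Fin N) → + toℕ α modFin N ≡ α
  modFin-toℕ α = toℕ-injective (≡.trans (toℕ-fromℕ< _) (m<n⇒m%n≡m (toℕ<n α)))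

  module _ {p n} (D : Angulation p (3 ℕ.+ n)) (λₚ : Carrier) {m} (F : IsFriezeOf D λₚ m) where
    open IsFriezeOf F
    open IsFrieze isFrieze

    quiddity-toℕ : ∀ α → m (+ toℕ α) (+ toℕ α) ≈ incidence D α · λₚ
    quiddity-toℕ α = ≡.subst (λ β → m (+ toℕ α) (+ toℕ α) ≈ incidence D β · λₚ)
      (modFin-toℕ α) (quiddity (+ toℕ α))

    -- The start `i` is arbitrary because removing the outermost map leaves a composition starting
    -- at `i + 1`. The last column `i + k - 1` stays fixed, so the two quotients share the entry of
    -- row `i + 1`. The indices form a general vector `f` so that the claim passes to `tail f`.
    foldr-ξ : ∀ i {k} (f : Fin k → Fin (3 ℕ.+ n)) → (∀ t → toℕ (f t) ≡ i ℕ.+ toℕ t) →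
              k ℕ.≤ 2 ℕ.+ n →
              foldr (ξ D λₚ) ∙ f
                ≈∙ (m (+ i) (+ (i ℕ.+ k) ℤ.- 1ℤ) ÷ m (+ suc i) (+ (i ℕ.+ k) ℤ.- 1ℤ))
    foldr-ξ i {zero} f _ _ = ÷-zeroʳ _ (entry-zero i)
      where
      -- The column `i - 1` is negative exactly when `i` is 0, so it computes only after a split on
      -- `i`.
      entry-zero : ∀ i → m (+ suc i) (+ (i ℕ.+ 0) ℤ.- 1ℤ) ≈ 0#
      entry-zero zero    = zeroˡ 1ℤ
      entry-zero (suc i) rewrite ℕ.+-identityʳ i = zeroˡ (+ suc (suc i))
    foldr-ξ i {suc k} f f-toℕ (ℕ.s≤s k≤1+n) =
      -- With `i + suc k` rewritten as `suc (i + k)`, the column computes to `+ (i + k)`, just as in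
      -- the induction hypothesis at `suc i`.
      ≡.subst (λ j → foldr (ξ D λₚ) ∙ f ≈∙ (m (+ i) (+ j ℤ.- 1ℤ) ÷ m (+ suc i) (+ j ℤ.- 1ℤ)))
        (≡.sym (ℕ.+-suc i k))
        (ξ-÷ (next-row-nonzero isFrieze i k k≤1+n)
          (trans (recurrence isFrieze i k k≤1+n) (*-congʳ quiddity-i))
          (foldr-ξ (suc i) (tail f) (λ t → ≡.trans (f-toℕ (suc t)) (ℕ.+-suc i (toℕ t)))
            (ℕ.m≤n⇒m≤1+n k≤1+n)))
      where
      quiddity-i : m (+ i) (+ i) ≈ incidence D (f zero) · λₚ
      quiddity-i = ≡.subst (λ j → m (+ j) (+ j) ≈ _)
        (≡.trans (f-toℕ zero) (ℕ.+-identityʳ i)) (quiddity-toℕ (f zero))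

lemma17 : ∀ {c ℓ₁ ℓ₂} (ℝ : Reals c ℓ₁ ℓ₂) →
    let open Reals ℝ in
    let open Friezes ℝ in
    ∀ (p n : ℕ) → 3 ℕ.≤ p → (D : Angulation p (3 ℕ.+ n)) →
    (λₚ : Carrier) → Is2Cosπ/ p λₚ →
    (m : ℤ → ℤ → Carrier) → IsFriezeOf D λₚ m →
    (α : Fin (3 ℕ.+ n)) →
    fareyVertex D λₚ α ≈∙ (m 0ℤ (+ toℕ α ℤ.- 1ℤ) ÷ m 1ℤ (+ toℕ α ℤ.- 1ℤ))
lemma17 ℝ p n _ D λₚ _ m F α =
  foldr-ξ D λₚ F 0 (inject {i = α}) toℕ-inject (ℕ.s≤s⁻¹ (toℕ<n α))
  where open FriezeProperties ℝ
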